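{- For every integer $n\ge 1$, $$B_{2^{n+1}-i}(t)-B_{2^{n}+i}(t)=\begin{cases} t(t-1)\,B_{2^{n-1}-i}(t) & \text{for } i=0,1,\dots,2^{n-1},\\ -t(t-1)\,B_{i-2^{n-1}}(t) & \text{for } i=2^{n-1}+1,\dots,2^{n}.\end{cases}$$
   Context: The Stern polynomials $B_n(t)\in\mathbb{Z}[t]$, $n\ge 0$, are defined by $B_0(t)=0$, $B_1(t)=1$, $B_{2n}(t)=tB_n(t)$ and $B_{2n+1}(t)=B_n(t)+B_{n+1}(t)$ for $n\ge 1$. -}

module Defs where

open import Data.Integer.Base as ℤ using (ℤ; 0ℤ; 1ℤ)
open import Data.List.Base using (List; []; _∷_; map)
open import Data.Nat.Base as ℕ
  using (ℕ; zero; suc; parity; ⌊_/2⌋; ⌈_/2⌉; NonZero)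
open import Data.Nat.Induction using (<-Rec; <-rec; <-wellFounded)
open import Data.Nat.Properties
  using (⌊n/2⌋<n; ⌈n/2⌉<n; n≡⌊n+n/2⌋; n≡⌈n+n/2⌉; +-identityʳ; +-suc; +-comm)
open import Data.Parity.Base using (Parity; 0ℙ; 1ℙ)
open import Induction.WellFounded using (module FixPoint)
open import Relation.Binary.PropositionalEquality
  using (_≡_; refl; sym; trans; cong; cong₂)

infix  4 _≈_
infixl 6 _+_ _-_
infixl 7 _*_
infix  8 -_

-- ℤ[t]: coefficient lists, constant term first.  Trailing zeros are allowed,
-- so equality of polynomials is _≈_ below and not _≡_.
Poly : Set
Poly = List ℤ

coeff : Poly → ℕ → ℤ
coeff []      k       = 0ℤ
coeff (a ∷ p) zero    = a
coeff (a ∷ p) (suc k) = coeff p k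

record _≈_ (p q : Poly) : Set where
  constructor mk≈
  field
    coeff-≡ : ∀ k → coeff p k ≡ coeff q k

open _≈_ public

0ₚ 1ₚ t : Poly
0ₚ = []
1ₚ = 1ℤ ∷ []
t  = 0ℤ ∷ 1ℤ ∷ []

_+_ : Poly → Poly → Poly
[]      + q       = q
(a ∷ p) + []      = a ∷ p
(a ∷ p) + (b ∷ q) = a ℤ.+ b ∷ p + q

-_ : Poly → Poly
- p = map ℤ.-_ p

_-_ : Poly → Poly → Poly
p - q = p + (- q)

-- (a + t p) q = a q + t (p q)
_*_ : Poly → Poly → Poly
[]      * q = []
(a ∷ p) * q = map (a ℤ.*_) q + (0ℤ ∷ p * q)

-- The right-hand side of the recurrence at an index m ≥ 2, given the parity
-- of m and the values at ⌊ m /2⌋ and ⌈ m /2⌉.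
combine : Parity → Poly → Poly → Poly
combine 0ℙ p q = t * p
combine 1ℙ p q = p + q

stern-step : ∀ n → <-Rec (λ _ → Poly) n → Poly
stern-step 0               rec = 0ₚ
stern-step 1               rec = 1ₚ
stern-step n@(suc (suc m)) rec =
  combine (parity n) (rec {⌊ n /2⌋} (⌊n/2⌋<n (suc m))) (rec {⌈ n /2⌉} (⌈n/2⌉<n m))

B : ℕ → Poly
B = <-rec (λ _ → Poly) stern-step

B-unfold : ∀ m → B (suc (suc m)) ≡
           combine (parity m) (B ⌊ suc (suc m) /2⌋) (B ⌈ suc (suc m) /2⌉)
B-unfold m = FixPoint.unfold-wfRec <-wellFounded (λ _ → Poly) stern-step ext
                                   {suc (suc m)}
  where
  ext : ∀ n {IH IH′ : <-Rec (λ _ → Poly) n} →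
        (∀ {y} y<n → IH {y} y<n ≡ IH′ y<n) → stern-step n IH ≡ stern-step n IH′
  ext 0             eq = refl
  ext 1             eq = refl
  ext (suc (suc m)) eq = cong₂ (combine (parity m)) (eq _) (eq _)

B-zero : B 0 ≡ 0ₚ
B-zero = refl

B-one : B 1 ≡ 1ₚ
B-one = refl

private
  parity-even : ∀ n → parity (n ℕ.+ n) ≡ 0ℙ
  parity-even zero    = refl
  parity-even (suc n) = trans (cong (λ m → parity (suc m)) (+-suc n n)) (parity-even n)

  parity-odd : ∀ n → parity (suc (n ℕ.+ n)) ≡ 1ℙ
  parity-odd zero    = refl
  parity-odd (suc n) = trans (cong parity (+-suc n n)) (parity-odd n)

  double : ∀ k → 2 ℕ.* suc k ≡ suc (suc (k ℕ.+ k))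
  double k = cong suc (trans (cong (k ℕ.+_) (+-identityʳ (suc k))) (+-suc k k))

  combine-even : ∀ {π p q p′} → π ≡ 0ℙ → p ≡ p′ → combine π p q ≡ t * p′
  combine-even refl refl = refl

  combine-odd : ∀ {π p q p′ q′} → π ≡ 1ℙ → p ≡ p′ → q ≡ q′ →
                combine π p q ≡ p′ + q′
  combine-odd refl refl refl = refl

B-even : ∀ n .{{_ : NonZero n}} → B (2 ℕ.* n) ≡ t * B n
B-even (suc k) =
  trans (cong B (double k))
 (trans (B-unfold (k ℕ.+ k))
        (combine-even (parity-even k)
                      (cong (λ m → B (suc m)) (sym (n≡⌊n+n/2⌋ k)))))

B-odd : ∀ n .{{_ : NonZero n}} → B (2 ℕ.* n ℕ.+ 1) ≡ B n + B (suc n)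
B-odd (suc k) =
  trans (cong B (trans (+-comm (2 ℕ.* suc k) 1) (cong suc (double k))))
 (trans (B-unfold (suc (k ℕ.+ k)))
        (combine-odd (parity-odd k)
                     (cong (λ m → B (suc m)) (sym (n≡⌈n+n/2⌉ k)))
                     (cong (λ m → B (suc (suc m))) (sym (n≡⌊n+n/2⌋ k)))))

{-# OPTIONS --safe #-}

-- Put N = 2^(n-1) and k = N - i.  The first case then reads
-- B(3N + k) - B(2N + i) = t(t-1) B(k) for i + k = N, with no subtraction left in
-- the indices.  It goes by induction on n: if i + k = 2N, then i and k have the
-- same parity; if both are even, the recurrence multiplies an earlier instance
-- by t, and if both are odd, it adds the two earlier instances
-- (⌈ i /2⌉ , ⌊ k /2⌋) and (⌊ i /2⌋ , ⌈ k /2⌉).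
-- The left-hand side changes sign under i ↦ 2N - i, which gives the second case.
module Submission where

open import Defs
open import Data.Integer.Base as ℤ using (0ℤ; 1ℤ)
import Data.Integer.Properties as ℤ
import Data.Integer.Tactic.RingSolver as ℤ-Solver
open import Data.List.Base using ([]; _∷_; map)
open import Data.Nat.Base as ℕ using (ℕ; zero; suc; _≤_; _^_; _∸_)
import Data.Nat.Properties as ℕ
import Data.Nat.Tactic.RingSolver as ℕ-Solver
open import Data.Product.Base using (_×_; _,_)
open import Relation.Binary.Bundles using (Setoid)
open import Relation.Binary.PropositionalEquality
  using (_≡_; refl; sym; trans; cong; cong₂; subst; module ≡-Reasoning)
import Relation.Binary.Reasoning.Setoid as ≈-Reasoning
open import Relation.Nullary.Negation using (contradiction)

-- Arithmetic of coefficient lists up to `_≈_`.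

≈-setoid : Setoid _ _
≈-setoid = record
  { Carrier       = Poly
  ; _≈_           = _≈_
  ; isEquivalence = record
    { refl  = mk≈ λ _ → refl
    ; sym   = λ p≈q → mk≈ λ k → sym (coeff-≡ p≈q k)
    ; trans = λ p≈q q≈r → mk≈ λ k → trans (coeff-≡ p≈q k) (coeff-≡ q≈r k)
    }
  }

open Setoid ≈-setoid using ()
  renaming (refl to ≈-refl; sym to ≈-sym; trans to ≈-trans; reflexive to ≈-reflexive)

-- Since `coeff` turns list addition into integer addition even for lists of different lengths, the
-- additive laws below follow from those of the integers at each index.
coeff-+ : ∀ p q k → coeff (p + q) k ≡ coeff p k ℤ.+ coeff q k
coeff-+ []      q       k       = sym (ℤ.+-identityˡ _)
coeff-+ (a ∷ p) []      k       = sym (ℤ.+-identityʳ _)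
coeff-+ (a ∷ p) (b ∷ q) zero    = refl
coeff-+ (a ∷ p) (b ∷ q) (suc k) = coeff-+ p q k

-- Past the end of the list the coefficient is the default `0ℤ`, which `f` must therefore fix.
coeff-map : ∀ {f} → f 0ℤ ≡ 0ℤ → ∀ p k → coeff (map f p) k ≡ f (coeff p k)
coeff-map f0≡0 []      k       = sym f0≡0
coeff-map f0≡0 (a ∷ p) zero    = refl
coeff-map f0≡0 (a ∷ p) (suc k) = coeff-map f0≡0 p k

coeff-scale : ∀ a p k → coeff (map (a ℤ.*_) p) k ≡ a ℤ.* coeff p k
coeff-scale a = coeff-map (ℤ.*-zeroʳ a)

coeff-‿- : ∀ p q k → coeff (p - q) k ≡ coeff p k ℤ.- coeff q k
coeff-‿- p q k =
  trans (coeff-+ p (- q) k) (cong (λ a → coeff p k ℤ.+ a) (coeff-map refl q k))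

∷-cong : ∀ {a b p q} → a ≡ b → p ≈ q → a ∷ p ≈ b ∷ q
∷-cong a≡b p≈q = mk≈ λ { zero → a≡b ; (suc k) → coeff-≡ p≈q k }

+-cong : ∀ {p p′ q q′} → p ≈ p′ → q ≈ q′ → p + q ≈ p′ + q′
+-cong {p} {p′} {q} {q′} p≈p′ q≈q′ = mk≈ λ k →
  trans (coeff-+ p q k)
 (trans (cong₂ ℤ._+_ (coeff-≡ p≈p′ k) (coeff-≡ q≈q′ k))
        (sym (coeff-+ p′ q′ k)))

map-cong-≈ : ∀ {f} → f 0ℤ ≡ 0ℤ → ∀ {p q} → p ≈ q → map f p ≈ map f q
map-cong-≈ {f} f0≡0 {p} {q} p≈q = mk≈ λ k →
  trans (coeff-map f0≡0 p k)
 (trans (cong f (coeff-≡ p≈q k)) (sym (coeff-map f0≡0 q k)))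

-‿cong : ∀ {p q} → p ≈ q → - p ≈ - q
-‿cong = map-cong-≈ refl

*-congˡ : ∀ p {q r} → q ≈ r → p * q ≈ p * r
*-congˡ []      q≈r = ≈-refl
*-congˡ (a ∷ p) q≈r =
  +-cong (map-cong-≈ (ℤ.*-zeroʳ a) q≈r) (∷-cong refl (*-congˡ p q≈r))

+-interchange : ∀ p q r s → (p + q) + (r + s) ≈ (p + r) + (q + s)
+-interchange p q r s = mk≈ λ k →
  trans (coeff-+ (p + q) (r + s) k)
 (trans (cong₂ ℤ._+_ (coeff-+ p q k) (coeff-+ r s k))
 (trans (lemma (coeff p k) (coeff q k) (coeff r k) (coeff s k))
 (sym (trans (coeff-+ (p + r) (q + s) k)
             (cong₂ ℤ._+_ (coeff-+ p r k) (coeff-+ q s k))))))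
  where
  lemma : ∀ a b c d → (a ℤ.+ b) ℤ.+ (c ℤ.+ d) ≡ (a ℤ.+ c) ℤ.+ (b ℤ.+ d)
  lemma = ℤ-Solver.solve-∀

neg-distrib-+ : ∀ p q → - (p + q) ≈ - p + - q
neg-distrib-+ p q = mk≈ λ k →
  trans (coeff-map refl (p + q) k)
 (trans (cong ℤ.-_ (coeff-+ p q k))
 (trans (ℤ.neg-distrib-+ (coeff p k) (coeff q k))
 (sym (trans (coeff-+ (- p) (- q) k)
             (cong₂ ℤ._+_ (coeff-map refl p k) (coeff-map refl q k))))))

neg-minus : ∀ p q → - (p - q) ≈ q - p
neg-minus p q = mk≈ λ k →
  trans (coeff-map refl (p - q) k)
 (trans (cong ℤ.-_ (coeff-‿- p q k))
 (trans (lemma (coeff p k) (coeff q k)) (sym (coeff-‿- q p k))))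
  where
  lemma : ∀ a b → ℤ.- (a ℤ.- b) ≡ b ℤ.- a
  lemma = ℤ-Solver.solve-∀

minus-self : ∀ p → p - p ≈ 0ₚ
minus-self p = mk≈ λ k → trans (coeff-‿- p p k) (ℤ.+-inverseʳ (coeff p k))

scale-distrib-+ : ∀ a p q →
  map (a ℤ.*_) (p + q) ≈ map (a ℤ.*_) p + map (a ℤ.*_) q
scale-distrib-+ a p q = mk≈ λ k →
  trans (coeff-scale a (p + q) k)
 (trans (cong (a ℤ.*_) (coeff-+ p q k))
 (trans (ℤ.*-distribˡ-+ a (coeff p k) (coeff q k))
 (sym (trans (coeff-+ (map (a ℤ.*_) p) (map (a ℤ.*_) q) k)
             (cong₂ ℤ._+_ (coeff-scale a p k) (coeff-scale a q k))))))

scale-neg : ∀ a p → map (ℤ.- a ℤ.*_) p ≈ - map (a ℤ.*_) p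
scale-neg a p = mk≈ λ k →
  trans (coeff-scale (ℤ.- a) p k)
 (trans (sym (ℤ.neg-distribˡ-* a (coeff p k)))
 (sym (trans (coeff-map refl (map (a ℤ.*_) p) k)
             (cong ℤ.-_ (coeff-scale a p k)))))

*-distribˡ-+ : ∀ p q r → p * (q + r) ≈ p * q + p * r
*-distribˡ-+ []      q r = ≈-refl
*-distribˡ-+ (a ∷ p) q r = begin
  map (a ℤ.*_) (q + r) + (0ℤ ∷ p * (q + r))
    ≈⟨ +-cong (scale-distrib-+ a q r) (∷-cong refl (*-distribˡ-+ p q r)) ⟩
  (map (a ℤ.*_) q + map (a ℤ.*_) r) + ((0ℤ ∷ p * q) + (0ℤ ∷ p * r))
    ≈⟨ +-interchange (map (a ℤ.*_) q) (map (a ℤ.*_) r) (0ℤ ∷ p * q) (0ℤ ∷ p * r) ⟩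
  (a ∷ p) * q + (a ∷ p) * r ∎
  where open ≈-Reasoning ≈-setoid

neg-distribˡ-* : ∀ p q → (- p) * q ≈ - (p * q)
neg-distribˡ-* []      q = ≈-refl
neg-distribˡ-* (a ∷ p) q = begin
  map (ℤ.- a ℤ.*_) q + (0ℤ ∷ (- p) * q)
    ≈⟨ +-cong (scale-neg a q) (∷-cong refl (neg-distribˡ-* p q)) ⟩
  - map (a ℤ.*_) q + - (0ℤ ∷ p * q)
    ≈⟨ neg-distrib-+ (map (a ℤ.*_) q) (0ℤ ∷ p * q) ⟨
  - ((a ∷ p) * q) ∎
  where open ≈-Reasoning ≈-setoid

*-zeroʳ : ∀ p → p * 0ₚ ≈ 0ₚ
*-zeroʳ []      = ≈-refl
*-zeroʳ (a ∷ p) = mk≈ λ { zero → refl ; (suc k) → coeff-≡ (*-zeroʳ p) k }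

-- Prepending `0ℤ` is multiplication by `t`. This pulls a factor `t` out of the right operand
-- without commutativity or associativity of `_*_`.
*-shiftʳ : ∀ p q → p * (0ℤ ∷ q) ≈ 0ℤ ∷ p * q
*-shiftʳ []      q = mk≈ λ { zero → refl ; (suc k) → refl }
*-shiftʳ (a ∷ p) q =
  ∷-cong (trans (ℤ.+-identityʳ _) (ℤ.*-zeroʳ a))
         (+-cong (≈-refl {map (a ℤ.*_) q}) (*-shiftʳ p q))

t*-shift : ∀ p → t * p ≈ 0ℤ ∷ p
t*-shift p = mk≈ λ k →
  trans (coeff-+ (map (0ℤ ℤ.*_) p) (0ℤ ∷ (1ℤ ∷ []) * p) k)
 (trans (cong (ℤ._+ coeff (0ℤ ∷ 1ₚ * p) k) (coeff-scale 0ℤ p k))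
 (trans (ℤ.+-identityˡ _) (coeff-≡ (∷-cong refl (mk≈ 1ₚ*p)) k)))
  where
  coeff-0ℤ∷[] : ∀ k → coeff (0ℤ ∷ []) k ≡ 0ℤ
  coeff-0ℤ∷[] zero    = refl
  coeff-0ℤ∷[] (suc k) = refl

  1ₚ*p : ∀ k → coeff (1ₚ * p) k ≡ coeff p k
  1ₚ*p k =
    trans (coeff-+ (map (1ℤ ℤ.*_) p) (0ℤ ∷ []) k)
   (trans (cong₂ ℤ._+_ (coeff-scale 1ℤ p k) (coeff-0ℤ∷[] k))
   (trans (ℤ.+-identityʳ _) (ℤ.*-identityˡ _)))

-- The Stern recurrences at every index, zero included.

B-2* : ∀ n → B (2 ℕ.* n) ≈ 0ℤ ∷ B n
-- Here `[]` is compared with `0ℤ ∷ []`: the same polynomial, but different lists.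
B-2* zero      = mk≈ λ { zero → refl ; (suc k) → refl }
B-2* n@(suc _) = ≈-trans (≈-reflexive (B-even n)) (t*-shift (B n))

B-1+2* : ∀ n → B (suc (2 ℕ.* n)) ≡ B n + B (suc n)
B-1+2* zero      = refl
B-1+2* n@(suc _) = trans (cong B (ℕ.+-comm 1 (2 ℕ.* n))) (B-odd n)

data Halving : ℕ → Set where
  even : ∀ a → Halving (2 ℕ.* a)
  odd  : ∀ a → Halving (suc (2 ℕ.* a))

halve : ∀ n → Halving n
halve zero = even 0
halve (suc n) with halve n
... | even a = odd a
... | odd  a = subst Halving (ℕ.*-suc 2 a) (even (suc a))

-- All three values acquire the same factor `t`, which is a shift of the coefficients and commutes
-- with subtraction and with `c *_`.
difference-double : ∀ c x y z → B x - B y ≈ c * B z →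
  B (2 ℕ.* x) - B (2 ℕ.* y) ≈ c * B (2 ℕ.* z)
difference-double c x y z eq = begin
  B (2 ℕ.* x) - B (2 ℕ.* y) ≈⟨ +-cong (B-2* x) (-‿cong (B-2* y)) ⟩
  -- The leading coefficient `0ℤ ℤ.- 0ℤ` computes to `0ℤ`.
  0ℤ ∷ (B x - B y)          ≈⟨ ∷-cong refl eq ⟩
  0ℤ ∷ c * B z              ≈⟨ *-shiftʳ c (B z) ⟨
  c * (0ℤ ∷ B z)            ≈⟨ *-congˡ c (B-2* z) ⟨
  c * B (2 ℕ.* z)           ∎
  where open ≈-Reasoning ≈-setoid

-- The odd recurrence splits each value in two, and the halves are paired crosswise, `x` with
-- `suc y` and `suc x` with `y`. In `reflection` this keeps the sum of the two offsets equal in both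
-- instances.
difference-double+1 : ∀ c x y z →
  B x - B (suc y) ≈ c * B z → B (suc x) - B y ≈ c * B (suc z) →
  B (suc (2 ℕ.* x)) - B (suc (2 ℕ.* y)) ≈ c * B (suc (2 ℕ.* z))
difference-double+1 c x y z eq₁ eq₂
  rewrite B-1+2* x | B-1+2* y | B-1+2* z = begin
  (B x + B (suc x)) - (B y + B (suc y))
    ≈⟨ +-cong (≈-refl {B x + B (suc x)})
              (≈-trans (-‿cong (+-comm (B y) (B (suc y))))
                       (neg-distrib-+ (B (suc y)) (B y))) ⟩
  (B x + B (suc x)) + (- B (suc y) + - B y)
    ≈⟨ +-interchange (B x) (B (suc x)) (- B (suc y)) (- B y) ⟩
  (B x - B (suc y)) + (B (suc x) - B y)
    ≈⟨ +-cong eq₁ eq₂ ⟩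
  c * B z + c * B (suc z)
    ≈⟨ *-distribˡ-+ c (B z) (B (suc z)) ⟨
  c * (B z + B (suc z)) ∎
  where
  open ≈-Reasoning ≈-setoid

  +-comm : ∀ p q → p + q ≈ q + p
  +-comm p q = mk≈ λ k →
    trans (coeff-+ p q k) (trans (ℤ.+-comm (coeff p k) (coeff q k)) (sym (coeff-+ q p k)))

-- The reflection identity.

double-affine : ∀ c N k → 2 ℕ.* (c ℕ.* N ℕ.+ k) ≡ c ℕ.* (2 ℕ.* N) ℕ.+ 2 ℕ.* k
double-affine = ℕ-Solver.solve-∀

double-affine+1 : ∀ c N k →
  suc (2 ℕ.* (c ℕ.* N ℕ.+ k)) ≡ c ℕ.* (2 ℕ.* N) ℕ.+ suc (2 ℕ.* k)
double-affine+1 = ℕ-Solver.solve-∀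

reflection : ∀ m i k → i ℕ.+ k ≡ 2 ^ m →
  B (3 ℕ.* 2 ^ m ℕ.+ k) - B (2 ℕ.* 2 ^ m ℕ.+ i) ≈ t * (t - 1ₚ) * B k
-- For `N = 1` and `k = 1` both sides are `t² - t`, since `B 4` is `t²` and `B 2` is `t`.
reflection zero 0 .1 refl = mk≈ λ
  { 0 → refl ; 1 → refl ; 2 → refl ; 3 → refl ; (suc (suc (suc (suc k)))) → refl }
-- For `k = 0` both indices on the left are 3, and `B 0` vanishes on the right.
reflection zero 1 0 refl = ≈-trans (minus-self (B 3)) (≈-sym (*-zeroʳ (t * (t - 1ₚ))))
reflection (suc m) i k i+k≡2N with halve i | halve k
-- The rewrites expose each index as a double, for example `3(2N) + 2b` as `2(3N + b)`.
... | even a | even b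
  rewrite sym (double-affine 3 (2 ^ m) b) | sym (double-affine 2 (2 ^ m) a) =
  difference-double (t * (t - 1ₚ)) (3 ℕ.* 2 ^ m ℕ.+ b) (2 ℕ.* 2 ^ m ℕ.+ a) b
    (reflection m a b
      (ℕ.*-cancelˡ-≡ _ _ 2 (trans (ℕ.*-distribˡ-+ 2 a b) i+k≡2N)))
... | odd a | odd b
  rewrite sym (double-affine+1 3 (2 ^ m) b) | sym (double-affine+1 2 (2 ^ m) a) =
  difference-double+1 (t * (t - 1ₚ)) (3 ℕ.* 2 ^ m ℕ.+ b) (2 ℕ.* 2 ^ m ℕ.+ a) b
    -- The offsets of the two earlier instances are `(suc a , b)` and `(a , suc b)`; each pair sums
    -- to `N` because `2(a + b + 1) = 2N`.
    (subst (λ y → B (3 ℕ.* 2 ^ m ℕ.+ b) - B y ≈ t * (t - 1ₚ) * B b)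
           (ℕ.+-suc (2 ℕ.* 2 ^ m) a) (reflection m (suc a) b a+b+1≡N))
    (subst (λ x → B x - B (2 ℕ.* 2 ^ m ℕ.+ a) ≈ t * (t - 1ₚ) * B (suc b))
           (ℕ.+-suc (3 ℕ.* 2 ^ m) b)
           (reflection m a (suc b) (trans (ℕ.+-suc a b) a+b+1≡N)))
  where
  double-sum : ∀ a b → 2 ℕ.* suc (a ℕ.+ b) ≡ suc (2 ℕ.* a) ℕ.+ suc (2 ℕ.* b)
  double-sum = ℕ-Solver.solve-∀

  a+b+1≡N : suc (a ℕ.+ b) ≡ 2 ^ m
  a+b+1≡N = ℕ.*-cancelˡ-≡ _ _ 2 (trans (double-sum a b) i+k≡2N)
... | even a | odd b = contradiction
  (trans (sym i+k≡2N)
         (trans (ℕ.+-suc (2 ℕ.* a) (2 ℕ.* b)) (cong suc (sym (ℕ.*-distribˡ-+ 2 a b)))))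
  (ℕ.even≢odd (2 ^ m) (a ℕ.+ b))
... | odd a | even b = contradiction
  (trans (sym i+k≡2N) (cong suc (sym (ℕ.*-distribˡ-+ 2 a b))))
  (ℕ.even≢odd (2 ^ m) (a ℕ.+ b))

-- N stands for 2 ^ m; naming d * N as j keeps 1 * N out of the case d = 1.
4N∸ : ∀ m c d i {j} → c ℕ.+ d ≡ 4 → i ≤ j → j ≡ d ℕ.* 2 ^ m →
  2 ^ (suc m ℕ.+ 1) ∸ i ≡ c ℕ.* 2 ^ m ℕ.+ (j ∸ i)
4N∸ m c d i {j} c+d≡4 i≤j j≡dN = begin
  2 ^ (suc m ℕ.+ 1) ∸ i           ≡⟨ cong (λ e → 2 ^ e ∸ i) (ℕ.+-comm (suc m) 1) ⟩
  2 ℕ.* (2 ℕ.* 2 ^ m) ∸ i         ≡⟨ cong (_∸ i) (ℕ.*-assoc 2 2 (2 ^ m)) ⟨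
  4 ℕ.* 2 ^ m ∸ i                 ≡⟨ cong (λ e → e ℕ.* 2 ^ m ∸ i) c+d≡4 ⟨
  (c ℕ.+ d) ℕ.* 2 ^ m ∸ i         ≡⟨ cong (_∸ i) (ℕ.*-distribʳ-+ (2 ^ m) c d) ⟩
  c ℕ.* 2 ^ m ℕ.+ d ℕ.* 2 ^ m ∸ i ≡⟨ cong (λ e → c ℕ.* 2 ^ m ℕ.+ e ∸ i) j≡dN ⟨
  c ℕ.* 2 ^ m ℕ.+ j ∸ i           ≡⟨ ℕ.+-∸-assoc (c ℕ.* 2 ^ m) i≤j ⟩
  c ℕ.* 2 ^ m ℕ.+ (j ∸ i)         ∎
  where open ≡-Reasoning

theorem2p3 : ∀ (n : ℕ) → 1 ≤ n →
    (∀ (i : ℕ) → i ≤ 2 ^ (n ∸ 1) →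
    B (2 ^ (n ℕ.+ 1) ∸ i) - B (2 ^ n ℕ.+ i)
    ≈ t * (t - 1ₚ) * B (2 ^ (n ∸ 1) ∸ i))
    × (∀ (i : ℕ) → 2 ^ (n ∸ 1) ℕ.+ 1 ≤ i → i ≤ 2 ^ n →
    B (2 ^ (n ℕ.+ 1) ∸ i) - B (2 ^ n ℕ.+ i)
    ≈ - (t * (t - 1ₚ)) * B (i ∸ 2 ^ (n ∸ 1)))
theorem2p3 (suc m) _ = lower , upper
  where
  N = 2 ^ m
  c = t * (t - 1ₚ)

  lower : ∀ i → i ≤ N →
    B (2 ^ (suc m ℕ.+ 1) ∸ i) - B (2 ^ suc m ℕ.+ i) ≈ c * B (N ∸ i)
  -- Splitting 4 as 3 + 1 gives `4N - i = 3N + (N - i)`, the larger index in `reflection`.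
  lower i i≤N rewrite 4N∸ m 3 1 i refl i≤N (sym (ℕ.*-identityˡ N)) =
    reflection m i (N ∸ i) (ℕ.m+[n∸m]≡n i≤N)

  upper : ∀ i → N ℕ.+ 1 ≤ i → i ≤ 2 ^ suc m →
    B (2 ^ (suc m ℕ.+ 1) ∸ i) - B (2 ^ suc m ℕ.+ i) ≈ - c * B (i ∸ N)
  upper i N<i i≤2N = begin
    B (2 ^ (suc m ℕ.+ 1) ∸ i) - B (2 ℕ.* N ℕ.+ i)
      -- With 4 split as 2 + 2, `4N - i = 2N + i′`, while `2N + i = 3N + k`. These are the two
      -- indices of `reflection` at `(i′ , k)` in exchanged order, whence the minus sign.
      ≡⟨ cong₂ (λ x y → B x - B y) (4N∸ m 2 2 i refl i≤2N refl) 2N+i≡3N+k ⟩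
    B (2 ℕ.* N ℕ.+ i′) - B (3 ℕ.* N ℕ.+ k)
      ≈⟨ neg-minus (B (3 ℕ.* N ℕ.+ k)) (B (2 ℕ.* N ℕ.+ i′)) ⟨
    - (B (3 ℕ.* N ℕ.+ k) - B (2 ℕ.* N ℕ.+ i′))
      ≈⟨ -‿cong (reflection m i′ k i′+k≡N) ⟩
    - (c * B k)
      ≈⟨ neg-distribˡ-* c (B k) ⟨
    - c * B k ∎
    where
    open ≈-Reasoning ≈-setoid

    i′ = 2 ℕ.* N ∸ i
    k  = i ∸ N

    N+k≡i : N ℕ.+ k ≡ i
    N+k≡i = ℕ.m+[n∸m]≡n (ℕ.m+n≤o⇒m≤o N N<i)

    2N+[N+k] : ∀ N k → 2 ℕ.* N ℕ.+ (N ℕ.+ k) ≡ 3 ℕ.* N ℕ.+ k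
    2N+[N+k] = ℕ-Solver.solve-∀

    2N+i≡3N+k : 2 ℕ.* N ℕ.+ i ≡ 3 ℕ.* N ℕ.+ k
    2N+i≡3N+k = trans (cong (2 ℕ.* N ℕ.+_) (sym N+k≡i)) (2N+[N+k] N k)

    swap : ∀ N i′ k → N ℕ.+ (i′ ℕ.+ k) ≡ i′ ℕ.+ (N ℕ.+ k)
    swap = ℕ-Solver.solve-∀

    i′+k≡N : i′ ℕ.+ k ≡ N
    i′+k≡N = ℕ.+-cancelˡ-≡ N _ _
      (trans (swap N i′ k)
      (trans (cong (i′ ℕ.+_) N+k≡i)
      (trans (ℕ.m∸n+n≡m i≤2N) (cong (N ℕ.+_) (ℕ.+-identityʳ N)))))
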